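{- Let $n\ge3$, let $\mathcal B_1$ be an $\mathrm{AI}$-crystal and $\mathcal B_2$ a $\mathfrak{gl}_n$-crystal. Then $\mathcal B_1\otimes\mathcal B_2:=\mathcal B_1\times\mathcal B_2$ (with $(b_1,b_2)$ written $b_1\otimes b_2$) is an $\mathrm{AI}$-crystal with the following structure maps, for $i\in\{1,\dots,n-1\}$: $$\deg_i(b_1\otimes b_2)=\begin{cases}\deg_i(b_1)-\varphi_i(b_2)+\varepsilon_i(b_2)&\text{if }\deg_i(b_1)>\varphi_i(b_2),\\ \varepsilon_i(b_2)&\text{if }\varphi_i(b_2)-\deg_i(b_1)\text{ is a nonnegative even integer},\\ \varepsilon_i(b_2)+1&\text{if }\varphi_i(b_2)-\deg_i(b_1)\text{ is a nonnegative odd integer},\end{cases}$$ $$\widetilde B_i(b_1\otimes b_2)=\begin{cases}\widetilde B_ib_1\otimes b_2&\text{if }\deg_i(b_1)>\varphi_i(b_2),\\ b_1\otimes\widetilde E_ib_2&\text{if }\varphi_i(b_2)-\deg_i(b_1)\text{ is a nonnegative even integer},\\ b_1\otimes\widetilde F_ib_2&\text{if }\varphi_i(b_2)-\deg_i(b_1)\text{ is a nonnegative odd integer}.\end{cases}$$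
   Context: An $\mathrm{AI}$-crystal (more precisely $\mathrm{AI}_{n-1}$-crystal) is a set $\mathcal B$ with maps $\widetilde B_i:\mathcal B\to\mathcal B\sqcup\{0\}$ and $\deg_i:\mathcal B\to\mathbb Z_{\ge0}$, $i\in\{1,\dots,n-1\}$ ($0$ a formal symbol), such that for all $b\in\mathcal B$ and $i,j$ with $\widetilde B_ib\ne0$: (1) $\deg_i(\widetilde B_ib)=\deg_i(b)$ and $\widetilde B_i^2b=b$; (2) if $|i-j|=1$ then $\deg_j(\widetilde B_ib)-\deg_j(b)\in\{1,-1\}$; (3) if $|i-j|>1$ then $\deg_j(\widetilde B_ib)=\deg_j(b)$. A $\mathfrak{gl}_n$-crystal here means a Stembridge crystal of type $\mathfrak{gl}_n$: a set $\mathcal B$ with maps $\widetilde E_i,\widetilde F_i:\mathcal B\to\mathcal B\sqcup\{0\}$, $\varepsilon_i,\varphi_i:\mathcal B\to\mathbb Z_{\ge0}$ ($1\le i\le n-1$) and $\mathrm{wt}:\mathcal B\to\mathbb Z^n$ satisfying the usual crystal axioms and Stembridge's local axioms; in particular, with $\widetilde E_i0=\widetilde F_i0=0$: $\widetilde F_ib=b'$ iff $b=\widetilde E_ib'$; $\varepsilon_i(b)=\max\{k:\widetilde E_i^kb\ne0\}$, $\varphi_i(b)=\max\{k:\widetilde F_i^kb\neq0\}$; if $|i-j|>1$ and $\widetilde E_ib\ne0$ then $\varepsilon_j(\widetilde E_ib)=\varepsilon_j(b)$, $\varphi_j(\widetilde E_ib)=\varphi_j(b)$ and $\widetilde E_j\widetilde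 E_ib=\widetilde E_i\widetilde E_jb$; if $|i-j|=1$ and $\widetilde E_ib\ne0$ then either $\varepsilon_j(\widetilde E_ib)=\varepsilon_j(b)$ and $\varphi_j(\widetilde E_ib)=\varphi_j(b)-1$, or $\varepsilon_j(\widetilde E_ib)=\varepsilon_j(b)+1$ and $\varphi_j(\widetilde E_ib)=\varphi_j(b)$. Convention: $0\otimes b_2=b_1\otimes0=0$. -}

module Defs where

open import Level using (Level; suc; _⊔_)
open import Data.Bool.Base using (if_then_else_)
open import Data.Fin.Base using (Fin; toℕ; inject₁)
open import Data.Integer.Base as ℤ using (ℤ; 0ℤ; 1ℤ; -1ℤ; _⊖_)
open import Data.Maybe.Base using (Maybe; just; nothing; map; _>>=_)
open import Data.Nat.Base as ℕ using (ℕ; _+_; _∸_; _≤_; _>_; ∣_-_∣)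
open import Data.Nat.Divisibility using (_∣?_)
open import Data.Nat.Properties using (_<?_)
open import Data.Product.Base using (_×_; _,_; ∃-syntax)
open import Data.Sum.Base using (_⊎_)
open import Data.Vec.Base using (Vec; lookup; replicate; zipWith; _[_]≔_)
open import Relation.Binary.PropositionalEquality.Core using (_≡_; _≢_)
open import Relation.Nullary.Decidable.Core using (does)

-- The index set {1,…,n-1}, shifted to start at 0.  The formal symbol 0
-- adjoined to a crystal is `nothing`, and _>>=_ extends operators by 0 ↦ 0.
Index : ℕ → Set
Index n = Fin (n ∸ 1)

Adjacent Distant : ∀ {n} → Index n → Index n → Set
Adjacent i j = ∣ toℕ i - toℕ j ∣ ≡ 1
Distant  i j = ∣ toℕ i - toℕ j ∣ > 1

-- The positions i and i+1 among the n coordinates of a weight.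
this next : ∀ {n} → Index n → Fin n
this {ℕ.suc n} i = inject₁ i
next {ℕ.suc n} i = Fin.suc i

simpleRoot : ∀ {n} → Index n → Vec ℤ n
simpleRoot i = (replicate _ 0ℤ [ this i ]≔ 1ℤ) [ next i ]≔ -1ℤ

iterate : ∀ {a} {A : Set a} → (A → Maybe A) → ℕ → A → Maybe A
iterate f ℕ.zero    x = just x
iterate f (ℕ.suc k) x = iterate f k x >>= f

IsMaximum : ∀ {p} → (ℕ → Set p) → ℕ → Set p
IsMaximum P m = P m × (∀ k → P k → k ≤ m)

record IsAICrystal {a} (n : ℕ) (C : Set a)
                   (B   : Index n → C → Maybe C)
                   (deg : Index n → C → ℕ) : Set a where
  field
    deg-B          : ∀ {i b b′} → B i b ≡ just b′ → deg i b′ ≡ deg i b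
    B-involutive   : ∀ {i b b′} → B i b ≡ just b′ → B i b′ ≡ just b
    deg-B-adjacent : ∀ {i j b b′} → Adjacent {n} i j → B i b ≡ just b′ →
                     (deg j b′ ⊖ deg j b ≡ 1ℤ) ⊎ (deg j b′ ⊖ deg j b ≡ -1ℤ)
    deg-B-distant  : ∀ {i j b b′} → Distant {n} i j → B i b ≡ just b′ →
                     deg j b′ ≡ deg j b

record AICrystal (n : ℕ) (a : Level) : Set (suc a) where
  field
    Carrier     : Set a
    B           : Index n → Carrier → Maybe Carrier
    deg         : Index n → Carrier → ℕ
    isAICrystal : IsAICrystal n Carrier B deg
  open IsAICrystal isAICrystal public

record IsGLCrystal {a} (n : ℕ) (C : Set a)
                   (E F : Index n → C → Maybe C)
                   (ε φ : Index n → C → ℕ)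
                   (wt  : C → Vec ℤ n) : Set a where
  field
    φ-ε : ∀ i b → φ i b ⊖ ε i b ≡ lookup (wt b) (this i) ℤ.- lookup (wt b) (next i)

    wt-E : ∀ {i b b′} → E i b ≡ just b′ → wt b′ ≡ zipWith ℤ._+_ (wt b) (simpleRoot i)
    ε-E  : ∀ {i b b′} → E i b ≡ just b′ → ℕ.suc (ε i b′) ≡ ε i b
    φ-E  : ∀ {i b b′} → E i b ≡ just b′ → φ i b′ ≡ ℕ.suc (φ i b)

    wt-F : ∀ {i b b′} → F i b ≡ just b′ → wt b′ ≡ zipWith ℤ._-_ (wt b) (simpleRoot i)
    ε-F  : ∀ {i b b′} → F i b ≡ just b′ → ε i b′ ≡ ℕ.suc (ε i b)
    φ-F  : ∀ {i b b′} → F i b ≡ just b′ → ℕ.suc (φ i b′) ≡ φ i b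

    F⇒E : ∀ {i b b′} → F i b ≡ just b′ → E i b′ ≡ just b
    E⇒F : ∀ {i b b′} → E i b′ ≡ just b → F i b ≡ just b′

    ε-max : ∀ i b → IsMaximum (λ k → iterate (E i) k b ≢ nothing) (ε i b)
    φ-max : ∀ i b → IsMaximum (λ k → iterate (F i) k b ≢ nothing) (φ i b)

    ε-E-distant : ∀ {i j b b′} → Distant {n} i j → E i b ≡ just b′ → ε j b′ ≡ ε j b
    φ-E-distant : ∀ {i j b b′} → Distant {n} i j → E i b ≡ just b′ → φ j b′ ≡ φ j b
    E-E-distant : ∀ {i j b b′} → Distant {n} i j → E i b ≡ just b′ →
                  (E i b >>= E j) ≡ (E j b >>= E i)

    E-adjacent : ∀ {i j b b′} → Adjacent {n} i j → E i b ≡ just b′ →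
                 (ε j b′ ≡ ε j b × ℕ.suc (φ j b′) ≡ φ j b) ⊎
                 (ε j b′ ≡ ℕ.suc (ε j b) × φ j b′ ≡ φ j b)

    -- Stembridge's relations for adjacent i, j: the operators either commute
    -- or satisfy the degree four relation E i E j² E i b = E j E i² E j b.
    E-square : ∀ {i j b x y} → Adjacent {n} i j →
               E i b ≡ just x → E j b ≡ just y → ε j x ≡ ε j b →
               φ i y ≡ φ i b ×
               ∃[ c ] (E j x ≡ just c × E i y ≡ just c)

    E-octagon : ∀ {i j b x y} → Adjacent {n} i j →
                E i b ≡ just x → E j b ≡ just y →
                ε j x ≡ ℕ.suc (ε j b) → ε i y ≡ ℕ.suc (ε i b) →
                ∃[ x′ ] ∃[ y′ ] ∃[ c ]
                  ( iterate (E j) 2 x ≡ just x′ × E i x′ ≡ just c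
                  × iterate (E i) 2 y ≡ just y′ × E j y′ ≡ just c
                  × φ i x′ ≡ φ i y × φ j y′ ≡ φ j x )

    F-square : ∀ {i j b x y} → Adjacent {n} i j →
               F i b ≡ just x → F j b ≡ just y → φ j x ≡ φ j b →
               ε i y ≡ ε i b ×
               ∃[ c ] (F j x ≡ just c × F i y ≡ just c)

    F-octagon : ∀ {i j b x y} → Adjacent {n} i j →
                F i b ≡ just x → F j b ≡ just y →
                φ j x ≡ ℕ.suc (φ j b) → φ i y ≡ ℕ.suc (φ i b) →
                ∃[ x′ ] ∃[ y′ ] ∃[ c ]
                  ( iterate (F j) 2 x ≡ just x′ × F i x′ ≡ just c
                  × iterate (F i) 2 y ≡ just y′ × F j y′ ≡ just c
                  × ε i x′ ≡ ε i y × ε j y′ ≡ ε j x )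

record GLCrystal (n : ℕ) (a : Level) : Set (suc a) where
  field
    Carrier     : Set a
    E F         : Index n → Carrier → Maybe Carrier
    ε φ         : Index n → Carrier → ℕ
    wt          : Carrier → Vec ℤ n
    isGLCrystal : IsGLCrystal n Carrier E F ε φ wt
  open IsGLCrystal isGLCrystal public

-- Three-way case distinction: d > p, or p - d nonnegative even, or
-- p - d nonnegative odd.
splitCases : ∀ {a} {A : Set a} (d p : ℕ) → A → A → A → A
splitCases d p greater even odd =
  if does (p <? d) then greater
  else if does (2 ∣? (p ∸ d)) then even
  else odd

module Tensor {n a₁ a₂} (B₁ : AICrystal n a₁) (B₂ : GLCrystal n a₂) where
  private
    module B₁ = AICrystal B₁
    module B₂ = GLCrystal B₂

  Carrier-⊗ : Set (a₁ ⊔ a₂)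
  Carrier-⊗ = B₁.Carrier × B₂.Carrier

  -- The truncated subtraction is exact, as its case has deg > φ.
  deg-⊗ : Index n → Carrier-⊗ → ℕ
  deg-⊗ i (b₁ , b₂) = splitCases (B₁.deg i b₁) (B₂.φ i b₂)
    ((B₁.deg i b₁ ∸ B₂.φ i b₂) + B₂.ε i b₂)
    (B₂.ε i b₂)
    (B₂.ε i b₂ + 1)

  B-⊗ : Index n → Carrier-⊗ → Maybe Carrier-⊗
  B-⊗ i (b₁ , b₂) = splitCases (B₁.deg i b₁) (B₂.φ i b₂)
    (map (_, b₂) (B₁.B i b₁))
    (map (b₁ ,_) (B₂.E i b₂))
    (map (b₁ ,_) (B₂.F i b₂))

{-# OPTIONS --safe #-}
module Submission where

-- A step b ↦ B_i b of the tensor product is a step of the first factor, an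
-- E_i-step of the second, or an F_i-step of the second, and the reverse of a
-- step is again a step: E_i raises φ_i by one and so turns the even case into
-- the odd one.  As a step changes the data of an adjacent index j by one unit
-- in exactly one of deg_j b₁, φ_j b₂, ε_j b₂, the remaining point is that
-- deg_j (b₁ ⊗ b₂), as a function of these three numbers, changes by exactly
-- one whenever one of them does.

open import Defs
open import Data.Bool.Base using (true; false)
open import Data.Integer.Base using (1ℤ; -1ℤ; _⊖_)
open import Data.Integer.Properties using ([1+m]⊖[1+n]≡m⊖n)
open import Data.Maybe.Base using (just; map)
open import Data.Maybe.Properties using (just-injective)
open import Data.Nat.Base using (ℕ; zero; suc; _+_; _∸_; _≥_)
open import Data.Nat.Divisibility using (_∣?_)
open import Data.Nat.Properties using (_<?_; +-comm; +-suc)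
open import Data.Product.Base using (_×_; _,_; ∃-syntax)
open import Data.Sum.Base using (_⊎_; inj₁; inj₂; swap)
open import Level using (Level; _⊔_)
open import Relation.Binary.PropositionalEquality
  using (_≡_; refl; sym; trans; cong; cong₂; module ≡-Reasoning)
open import Relation.Nullary.Decidable.Core using (does)

open ≡-Reasoning

private
  variable
    a b : Level
    A : Set a
    C : Set b

map-just : ∀ (f : A → C) {m y} → map f m ≡ just y → ∃[ x ] (m ≡ just x × f x ≡ y)
map-just f {just x} eq = x , refl , just-injective eq

-- A form of "the integer difference is 1 or -1" free of subtraction, so that it can be rewritten
-- with and is symmetric by `swap`.
Consecutive : ℕ → ℕ → Set
Consecutive m n = m ≡ suc n ⊎ n ≡ suc m

suc⊖ : ∀ n → suc n ⊖ n ≡ 1ℤ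
suc⊖ zero    = refl
suc⊖ (suc n) = trans ([1+m]⊖[1+n]≡m⊖n (suc n) n) (suc⊖ n)

⊖suc : ∀ n → n ⊖ suc n ≡ -1ℤ
⊖suc zero    = refl
⊖suc (suc n) = trans ([1+m]⊖[1+n]≡m⊖n n (suc n)) (⊖suc n)

consecutive⇒⊖ : ∀ {m n} → Consecutive m n → (m ⊖ n ≡ 1ℤ) ⊎ (m ⊖ n ≡ -1ℤ)
consecutive⇒⊖ {n = n} (inj₁ refl) = inj₁ (suc⊖ n)
consecutive⇒⊖ {m = m} (inj₂ refl) = inj₂ (⊖suc m)

⊖⇒consecutive : ∀ m n → (m ⊖ n ≡ 1ℤ) ⊎ (m ⊖ n ≡ -1ℤ) → Consecutive m n
⊖⇒consecutive zero          zero          (inj₁ ())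
⊖⇒consecutive zero          zero          (inj₂ ())
⊖⇒consecutive zero          (suc zero)    _         = inj₂ refl
⊖⇒consecutive zero          (suc (suc _)) (inj₁ ())
⊖⇒consecutive zero          (suc (suc _)) (inj₂ ())
⊖⇒consecutive (suc zero)    zero          _         = inj₁ refl
⊖⇒consecutive (suc (suc _)) zero          (inj₁ ())
⊖⇒consecutive (suc (suc _)) zero          (inj₂ ())
⊖⇒consecutive (suc m)       (suc n)       eq
  rewrite [1+m]⊖[1+n]≡m⊖n m n with ⊖⇒consecutive m n eq
... | inj₁ m≡1+n = inj₁ (cong suc m≡1+n)
... | inj₂ n≡1+m = inj₂ (cong suc n≡1+m)

data Branch : Set where
  greater even odd : Branch

-- The case taken by `splitCases`, reified so that one equation governs both `B-⊗` and `deg-⊗`.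
branch : ℕ → ℕ → Branch
branch d p = splitCases d p greater even odd

select : Branch → A → A → A → A
select greater x y z = x
select even    x y z = y
select odd     x y z = z

splitCases-select : ∀ d p (x y z : A) → splitCases d p x y z ≡ select (branch d p) x y z
splitCases-select d p x y z with does (p <? d) | does (2 ∣? (p ∸ d))
... | true  | _     = refl
... | false | true  = refl
... | false | false = refl

splitCases-branch : ∀ d p {c} (x y z : A) → branch d p ≡ c → splitCases d p x y z ≡ select c x y z
splitCases-branch d p x y z refl = splitCases-select d p x y z

-- `branch` computes: a common successor cancels from both arguments, and at `d = 0` two successors
-- of `p` drop out by parity.
even⇒odd : ∀ d p → branch d p ≡ even → branch d (suc p) ≡ odd
even⇒odd zero    zero          _  = refl
even⇒odd zero    (suc zero)    ()
even⇒odd zero    (suc (suc p)) eq = even⇒odd zero p eq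
even⇒odd (suc d) zero          ()
even⇒odd (suc d) (suc p)       eq = even⇒odd d p eq

-- An odd difference `suc p - d` is at least one, so `d ≤ p` and passing to `p` cannot enter the
-- `greater` case.
odd⇒even : ∀ d p → branch d (suc p) ≡ odd → branch d p ≡ even
odd⇒even zero          zero          _  = refl
odd⇒even zero          (suc zero)    ()
odd⇒even zero          (suc (suc p)) eq = odd⇒even zero p eq
odd⇒even (suc zero)    zero          ()
odd⇒even (suc (suc d)) zero          ()
odd⇒even (suc d)       (suc p)       eq = odd⇒even d p eq

-- `deg-⊗` unfolds definitionally to this function of three numbers.
degree : ℕ → ℕ → ℕ → ℕ
degree d p e = splitCases d p ((d ∸ p) + e) e (e + 1)

-- For fixed `p` and `e`, the graph in `d` zigzags between `e` and `e + 1` up to `d = p`, where it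
-- equals `e`, and then has slope one.
degree-consecutive₁ : ∀ d p e → Consecutive (degree (suc d) p e) (degree d p e)
degree-consecutive₁ zero    zero          e = inj₁ refl
degree-consecutive₁ (suc d) zero          e = inj₁ refl
degree-consecutive₁ zero    (suc zero)    e = inj₂ (+-comm e 1)
-- By periodicity the goal compares `degree 0 (suc p) e` with `degree 0 p e`; the recursive call
-- compares the same two in the other order.
degree-consecutive₁ zero    (suc (suc p)) e = swap (degree-consecutive₁ zero (suc p) e)
degree-consecutive₁ (suc d) (suc p)       e = degree-consecutive₁ d p e

-- degree d p e depends on d and p only through d - p.
degree-consecutive₂ : ∀ d p e → Consecutive (degree d p e) (degree d (suc p) e)
degree-consecutive₂ d p e = degree-consecutive₁ d (suc p) e

degree-suc : ∀ d p e → degree d p (suc e) ≡ suc (degree d p e)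
degree-suc d p e with does (p <? d) | does (2 ∣? (p ∸ d))
... | true  | _     = +-suc (d ∸ p) e
... | false | true  = refl
... | false | false = refl

module _ {n a₁ a₂} (B₁ : AICrystal n a₁) (B₂ : GLCrystal n a₂) where
  private
    module B₁ = AICrystal B₁
    module B₂ = GLCrystal B₂
  open Tensor B₁ B₂

  branch-⊗ : Index n → Carrier-⊗ → Branch
  branch-⊗ i (b₁ , b₂) = branch (B₁.deg i b₁) (B₂.φ i b₂)

  -- The graph of `B-⊗`, with the case stored as an equation; matching on a step replaces unfolding
  -- `splitCases`.
  data Step (i : Index n) : Carrier-⊗ → Carrier-⊗ → Set (a₁ ⊔ a₂) where
    left  : ∀ {b₁ b₁′ b₂} → branch-⊗ i (b₁ , b₂) ≡ greater →
            B₁.B i b₁ ≡ just b₁′ → Step i (b₁ , b₂) (b₁′ , b₂)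
    raise : ∀ {b₁ b₂ b₂′} → branch-⊗ i (b₁ , b₂) ≡ even →
            B₂.E i b₂ ≡ just b₂′ → Step i (b₁ , b₂) (b₁ , b₂′)
    lower : ∀ {b₁ b₂ b₂′} → branch-⊗ i (b₁ , b₂) ≡ odd →
            B₂.F i b₂ ≡ just b₂′ → Step i (b₁ , b₂) (b₁ , b₂′)

  B-⊗-branch : ∀ i b₁ b₂ {c} → branch-⊗ i (b₁ , b₂) ≡ c → B-⊗ i (b₁ , b₂) ≡
    select c (map (_, b₂) (B₁.B i b₁)) (map (b₁ ,_) (B₂.E i b₂)) (map (b₁ ,_) (B₂.F i b₂))
  B-⊗-branch i b₁ b₂ = splitCases-branch (B₁.deg i b₁) (B₂.φ i b₂) _ _ _

  deg-⊗-branch : ∀ i b₁ b₂ {c} → branch-⊗ i (b₁ , b₂) ≡ c → deg-⊗ i (b₁ , b₂) ≡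
    select c ((B₁.deg i b₁ ∸ B₂.φ i b₂) + B₂.ε i b₂) (B₂.ε i b₂) (B₂.ε i b₂ + 1)
  deg-⊗-branch i b₁ b₂ = splitCases-branch (B₁.deg i b₁) (B₂.φ i b₂) _ _ _

  B-⊗⇒step : ∀ {i b b′} → B-⊗ i b ≡ just b′ → Step i b b′
  -- The branch is generalised together with its defining equation, which the constructors must
  -- store.
  B-⊗⇒step {i} {b₁ , b₂} eq = go _ refl
    where
    go : ∀ c → branch-⊗ i (b₁ , b₂) ≡ c → Step i (b₁ , b₂) _
    go greater c with map-just (_, b₂) (trans (sym (B-⊗-branch i b₁ b₂ c)) eq)
    ... | _ , B≡ , refl = left c B≡
    go even c with map-just (b₁ ,_) (trans (sym (B-⊗-branch i b₁ b₂ c)) eq)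
    ... | _ , E≡ , refl = raise c E≡
    go odd c with map-just (b₁ ,_) (trans (sym (B-⊗-branch i b₁ b₂ c)) eq)
    ... | _ , F≡ , refl = lower c F≡

  step⇒B-⊗ : ∀ {i b b′} → Step i b b′ → B-⊗ i b ≡ just b′
  step⇒B-⊗ (left  c B≡) = trans (B-⊗-branch _ _ _ c) (cong (map _) B≡)
  step⇒B-⊗ (raise c E≡) = trans (B-⊗-branch _ _ _ c) (cong (map _) E≡)
  step⇒B-⊗ (lower c F≡) = trans (B-⊗-branch _ _ _ c) (cong (map _) F≡)

  E-even⇒odd : ∀ {i b₁ b₂ b₂′} → B₂.E i b₂ ≡ just b₂′ →
               branch-⊗ i (b₁ , b₂) ≡ even → branch-⊗ i (b₁ , b₂′) ≡ odd
  E-even⇒odd {i} {b₁} E≡ c =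
    trans (cong (branch (B₁.deg i b₁)) (B₂.φ-E E≡)) (even⇒odd (B₁.deg i b₁) _ c)

  F-odd⇒even : ∀ {i b₁ b₂ b₂′} → B₂.F i b₂ ≡ just b₂′ →
               branch-⊗ i (b₁ , b₂) ≡ odd → branch-⊗ i (b₁ , b₂′) ≡ even
  F-odd⇒even {i} {b₁} F≡ c =
    odd⇒even (B₁.deg i b₁) _ (trans (cong (branch (B₁.deg i b₁)) (B₂.φ-F F≡)) c)

  step-sym : ∀ {i b b′} → Step i b b′ → Step i b′ b
  step-sym {i} (left {b₂ = b₂} c B≡) =
    left (trans (cong (λ d → branch d (B₂.φ i b₂)) (B₁.deg-B B≡)) c) (B₁.B-involutive B≡)
  step-sym (raise c E≡) = lower (E-even⇒odd E≡ c) (B₂.E⇒F E≡)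
  step-sym (lower c F≡) = raise (F-odd⇒even F≡ c) (B₂.F⇒E F≡)

  -- `E i` lowers `ε i` by one, and the `+ 1` of the odd case restores it.
  deg-raise : ∀ {i b₁ b₂ b₂′} → branch-⊗ i (b₁ , b₂) ≡ even → B₂.E i b₂ ≡ just b₂′ →
              deg-⊗ i (b₁ , b₂′) ≡ deg-⊗ i (b₁ , b₂)
  deg-raise {i} {b₁} {b₂} {b₂′} c E≡ = begin
    deg-⊗ i (b₁ , b₂′)  ≡⟨ deg-⊗-branch i b₁ b₂′ (E-even⇒odd E≡ c) ⟩
    B₂.ε i b₂′ + 1      ≡⟨ +-comm _ 1 ⟩
    suc (B₂.ε i b₂′)    ≡⟨ B₂.ε-E E≡ ⟩
    B₂.ε i b₂           ≡⟨ deg-⊗-branch i b₁ b₂ c ⟨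
    deg-⊗ i (b₁ , b₂)   ∎

  deg-step : ∀ {i b b′} → Step i b b′ → deg-⊗ i b′ ≡ deg-⊗ i b
  deg-step {i} (left {b₂ = b₂} c B≡) =
    cong (λ d → degree d (B₂.φ i b₂) (B₂.ε i b₂)) (B₁.deg-B B≡)
  deg-step (raise c E≡) = deg-raise c E≡
  -- A `lower` step is a `raise` step read from its endpoint.
  deg-step (lower c F≡) = sym (deg-raise (F-odd⇒even F≡ c) (B₂.F⇒E F≡))

  deg-E-distant : ∀ {i j b₁ b₂ b₂′} → Distant {n} i j → B₂.E i b₂ ≡ just b₂′ →
                  deg-⊗ j (b₁ , b₂′) ≡ deg-⊗ j (b₁ , b₂)
  deg-E-distant {j = j} {b₁} i≁j E≡ =
    cong₂ (degree (B₁.deg j b₁)) (B₂.φ-E-distant i≁j E≡) (B₂.ε-E-distant i≁j E≡)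

  deg-step-distant : ∀ {i j b b′} → Distant {n} i j → Step i b b′ → deg-⊗ j b′ ≡ deg-⊗ j b
  deg-step-distant {j = j} i≁j (left {b₂ = b₂} _ B≡) =
    cong (λ d → degree d (B₂.φ j b₂) (B₂.ε j b₂)) (B₁.deg-B-distant i≁j B≡)
  deg-step-distant i≁j (raise _ E≡) = deg-E-distant i≁j E≡
  deg-step-distant i≁j (lower _ F≡) = sym (deg-E-distant i≁j (B₂.F⇒E F≡))

  deg-E-adjacent : ∀ {i j b₁ b₂ b₂′} → Adjacent {n} i j → B₂.E i b₂ ≡ just b₂′ →
                   Consecutive (deg-⊗ j (b₁ , b₂′)) (deg-⊗ j (b₁ , b₂))
  deg-E-adjacent {j = j} {b₁} {b₂} {b₂′} i∼j E≡ with B₂.E-adjacent i∼j E≡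
  -- Here `φ j` drops, so `b₂′` carries the smaller value and everything is expressed through it.
  ... | inj₁ (ε≡ , φ≡) rewrite ε≡ | sym φ≡ =
    degree-consecutive₂ (B₁.deg j b₁) (B₂.φ j b₂′) (B₂.ε j b₂)
  ... | inj₂ (ε≡ , φ≡) rewrite ε≡ | φ≡ =
    inj₁ (degree-suc (B₁.deg j b₁) (B₂.φ j b₂) (B₂.ε j b₂))

  deg-step-adjacent : ∀ {i j b b′} → Adjacent {n} i j → Step i b b′ →
                      Consecutive (deg-⊗ j b′) (deg-⊗ j b)
  deg-step-adjacent {j = j} i∼j (left {b₁} {b₁′} {b₂} _ B≡)
    with ⊖⇒consecutive (B₁.deg j b₁′) (B₁.deg j b₁) (B₁.deg-B-adjacent i∼j B≡)
  ... | inj₁ d≡ rewrite d≡ = degree-consecutive₁ (B₁.deg j b₁) (B₂.φ j b₂) (B₂.ε j b₂)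
  -- The degree of the first factor drops, so the comparison starts from `b₁′`.
  ... | inj₂ d≡ rewrite d≡ = swap (degree-consecutive₁ (B₁.deg j b₁′) (B₂.φ j b₂) (B₂.ε j b₂))
  deg-step-adjacent i∼j (raise _ E≡) = deg-E-adjacent i∼j E≡
  deg-step-adjacent i∼j (lower _ F≡) = swap (deg-E-adjacent i∼j (B₂.F⇒E F≡))

proposition2p3p6 : ∀ {a₁ a₂ : Level} (n : ℕ) → n ≥ 3 →
    (B₁ : AICrystal n a₁) (B₂ : GLCrystal n a₂) →
    IsAICrystal n (Tensor.Carrier-⊗ B₁ B₂) (Tensor.B-⊗ B₁ B₂) (Tensor.deg-⊗ B₁ B₂)
proposition2p3p6 n _ B₁ B₂ = record
  { deg-B          = λ {_} {b} eq → deg-step B₁ B₂ (B-⊗⇒step B₁ B₂ {b = b} eq)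
  ; B-involutive   = λ {_} {b} eq → step⇒B-⊗ B₁ B₂ (step-sym B₁ B₂ (B-⊗⇒step B₁ B₂ {b = b} eq))
  ; deg-B-adjacent = λ {_} {_} {b} i∼j eq →
      consecutive⇒⊖ (deg-step-adjacent B₁ B₂ i∼j (B-⊗⇒step B₁ B₂ {b = b} eq))
  ; deg-B-distant  = λ {_} {_} {b} i≁j eq →
      deg-step-distant B₁ B₂ i≁j (B-⊗⇒step B₁ B₂ {b = b} eq)
  }
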